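{- Let $(\mathcal{M},\mathcal{N})$ be a preadhesive structure on a category $\mathbf{X}$ with pullbacks such that every arrow in $\mathcal{M}$ is $\mathcal{N}$-adhesive, $\mathcal{M}\cap\mathcal{N}$ contains every split monomorphism and $\mathcal{M}$ is closed under $\mathcal{M},\mathcal{N}$-unions. Then: (1) the Yoneda embedding $\mathcal{Y}_{\mathbf{X}}:\mathbf{X}\to\mathbf{Set}^{\mathbf{X}^{op}}$ factors through a full and faithful functor $\mathcal{Y}'_{\mathbf{X}}:\mathbf{X}\to\mathbf{Sh}(\mathbf{X},\mathfrak{j}_{\mathcal{M},\mathcal{N}})$; (2) $\mathcal{Y}'_{\mathbf{X}}$ preserves pullbacks and sends $\mathcal{M},\mathcal{N}$-pushouts to pushouts.
   Context: Classes of arrows. A class $\mathcal{A}$ of arrows is stable under pullbacks (resp. pushouts) if for every pullback (resp. pushout) square with $f:A\to B$, $m:A\to C$, $n:B\to D$, $g:C\to D$, $n\circ f=g\circ m$, $n\in\mathcal{A}$ implies $m\in\mathcal{A}$ (resp. $m\in\mathcal{A}$ implies $n\in\mathcal{A}$); existence of the (co)limits is not assumed. $\mathcal{A}$ is closed under $\mathcal{B}$-decomposition if $g\circ f\in\mathcal{A}$ and $g\in\mathcal{B}$ imply $f\in\mathcal{A}$; closed under decomposition means closed under $\mathcal{A}$-decomposition. Preadhesive structure. A pair $(\mathcal{M},\mathcal{N})$ with $\mathcal{M}$ a class of monomorphisms and $\mathcal{N}$ a class of arrows of $\mathbf{X}$ such that: (1) $\mathcal{M}$ and $\mathcal{N}$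 contain all isomorphisms and are closed under composition and decomposition; (2) $\mathcal{N}$ is closed under $\mathcal{M}$-decomposition; (3) $\mathcal{M}$ and $\mathcal{N}$ are stable under pullbacks and pushouts. An $\mathcal{M},\mathcal{N}$-pushout is a pushout square of an arrow $m\in\mathcal{M}$ along an arrow $n\in\mathcal{N}$ with the same domain. Stable pushouts. A pushout square $g:A\to B$, $m:A\to C$, $n:B\to D$, $f:C\to D$ is stable if for every commutative cube having it as bottom face, with vertical arrows $a:A'\to A$, $b:B'\to B$, $c:C'\to C$, $d:D'\to D$, if all four vertical faces are pullbacks then the top face is a pushout. $\mathcal{N}$-adhesive arrows. An arrow $m:X\to Y$ is $\mathcal{N}$-preadhesive if for every $n:X\to Z$ in $\mathcal{N}$ a stable pushout square of $m$ along $n$ exists and it is also a pullback square. It is $\mathcal{N}$-adhesive if all its pullbacks are $\mathcal{N}$-preadhesive. Unions. $(\mathsf{Sub}(X),\le)$ is the poset of subobjects of $X$ (isomorphism classes $[m]$ of monos into $X$, ordered by factorization). A mono $u:U\to X$ is an $\mathcal{M},\mathcal{N}$-union if there are $m\in\mathcal{M}$ and $n\in\mathcal{M}\cap\mathcal{N}$ with codomain $X$ such that $[u]=[m]\vee[n]$ in $(\mathsf{Sub}(X),\le)$. $\mathcal{M}$ is closed under $\mathcal{M},\mathcal{N}$-unions if it contains all such monos. The coverage. A $\mathfrak{j}_{\mathcal{M},\mathcal{N}}$-covering family for an object $X$ is a set $\{p,q\}$ of arrows $p:Z\to X$, $q:Y\to X$ for which there exist $m:N\to Y$ in $\mathcal{M}$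 and $n:N\to Z$ in $\mathcal{N}$ such that $p\circ n=q\circ m$ is a pushout square. $\mathfrak{j}_{\mathcal{M},\mathcal{N}}(X)$ is the set of these families. $\mathbf{Sh}(\mathbf{X},\mathfrak{j}_{\mathcal{M},\mathcal{N}})$ is the full subcategory of $\mathbf{Set}^{\mathbf{X}^{op}}$ on the sheaves: functors $F:\mathbf{X}^{op}\to\mathbf{Set}$ such that for every covering family $\{f_i:Y_i\to X\}_{i\in I}$ and every compatible family $a_i\in F(Y_i)$ (i.e. $F(g)(a_i)=F(h)(a_j)$ whenever $f_i\circ g=f_j\circ h$) there is a unique $a\in F(X)$ with $F(f_i)(a)=a_i$ for all $i$. A split monomorphism is an arrow having a left inverse. -}

module Defs where

open import Level using (Level; _⊔_; 0ℓ) renaming (suc to lsuc)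
open import Data.Bool.Base using (Bool; true; false)
open import Data.Product using (Σ; ∃; ∃!; _×_; _,_; proj₁; proj₂; Σ-syntax; ∃-syntax)
open import Function.Base using (_on_)
open import Function.Bundles using (Func; _⟨$⟩_)
import Function.Construct.Composition as Comp
import Function.Construct.Identity as Id
open import Relation.Binary.Bundles using (Setoid; Poset)
open import Relation.Binary.Structures using (IsEquivalence)
open import Relation.Binary.PropositionalEquality.Core using (_≡_; subst₂)

private
  variable
    o ℓ e o′ ℓ′ e′ o″ ℓ″ e″ p q r : Level

-- Categories have hom-setoids: _≈_ is the equality of parallel arrows.  The
-- category of sets is accordingly the category of setoids.

record Category (o ℓ e : Level) : Set (lsuc (o ⊔ ℓ ⊔ e)) where
  infix  4 _≈_ _⇒_
  infixr 9 _∘_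
  field
    Obj : Set o
    _⇒_ : Obj → Obj → Set ℓ
    _≈_ : ∀ {A B} → A ⇒ B → A ⇒ B → Set e
    id  : ∀ {A} → A ⇒ A
    _∘_ : ∀ {A B C} → B ⇒ C → A ⇒ B → A ⇒ C

    isEquivalence : ∀ {A B} → IsEquivalence (_≈_ {A} {B})
    ∘-cong        : ∀ {A B C} {f h : B ⇒ C} {g k : A ⇒ B} →
                    f ≈ h → g ≈ k → f ∘ g ≈ h ∘ k
    assoc         : ∀ {A B C D} {f : A ⇒ B} {g : B ⇒ C} {h : C ⇒ D} →
                    (h ∘ g) ∘ f ≈ h ∘ (g ∘ f)
    identityˡ     : ∀ {A B} {f : A ⇒ B} → id ∘ f ≈ f
    identityʳ     : ∀ {A B} {f : A ⇒ B} → f ∘ id ≈ f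

  module Equiv {A B : Obj} = IsEquivalence (isEquivalence {A} {B})

  hom-setoid : Obj → Obj → Setoid ℓ e
  hom-setoid A B = record { Carrier = A ⇒ B ; _≈_ = _≈_ ; isEquivalence = isEquivalence }

record Functor (C : Category o ℓ e) (D : Category o′ ℓ′ e′) :
               Set (o ⊔ ℓ ⊔ e ⊔ o′ ⊔ ℓ′ ⊔ e′) where
  private
    module C = Category C
    module D = Category D
  field
    F₀           : C.Obj → D.Obj
    F₁           : ∀ {A B} → A C.⇒ B → F₀ A D.⇒ F₀ B
    identity     : ∀ {A} → F₁ (C.id {A}) D.≈ D.id
    homomorphism : ∀ {X Y Z} {f : X C.⇒ Y} {g : Y C.⇒ Z} →
                   F₁ (g C.∘ f) D.≈ F₁ g D.∘ F₁ f
    F-cong       : ∀ {A B} {f g : A C.⇒ B} → f C.≈ g → F₁ f D.≈ F₁ g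

infixr 9 _∘F_
_∘F_ : {C : Category o ℓ e} {D : Category o′ ℓ′ e′} {E : Category o″ ℓ″ e″} →
       Functor D E → Functor C D → Functor C E
_∘F_ {E = E} G F = record
  { F₀           = λ A → G.F₀ (F.F₀ A)
  ; F₁           = λ f → G.F₁ (F.F₁ f)
  ; identity     = E.Equiv.trans (G.F-cong F.identity) G.identity
  ; homomorphism = E.Equiv.trans (G.F-cong F.homomorphism) G.homomorphism
  ; F-cong       = λ f≈g → G.F-cong (F.F-cong f≈g)
  }
  where
    module E = Category E
    module F = Functor F
    module G = Functor G

-- Strict equality of functors, not natural isomorphism.
infix 4 _≡F_
record _≡F_ {C : Category o ℓ e} {D : Category o′ ℓ′ e′} (F G : Functor C D) :
            Set (o ⊔ ℓ ⊔ e ⊔ o′ ⊔ ℓ′ ⊔ e′) where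
  private
    module C = Category C
    module D = Category D
    module F = Functor F
    module G = Functor G
  field
    eq₀ : ∀ A → F.F₀ A ≡ G.F₀ A
    eq₁ : ∀ {A B} (f : A C.⇒ B) →
          subst₂ D._⇒_ (eq₀ A) (eq₀ B) (F.F₁ f) D.≈ G.F₁ f

module _ {C : Category o ℓ e} {D : Category o′ ℓ′ e′} (F : Functor C D) where
  private
    module C = Category C
    module D = Category D
  open Functor F

  Full : Set (o ⊔ ℓ ⊔ ℓ′ ⊔ e′)
  Full = ∀ {A B} (g : F₀ A D.⇒ F₀ B) → ∃[ f ] F₁ {A} {B} f D.≈ g

  Faithful : Set (o ⊔ ℓ ⊔ e ⊔ e′)
  Faithful = ∀ {A B} (f g : A C.⇒ B) → F₁ f D.≈ F₁ g → f C.≈ g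

op : Category o ℓ e → Category o ℓ e
op C = record
  { Obj           = C.Obj
  ; _⇒_           = λ A B → B C.⇒ A
  ; _≈_           = C._≈_
  ; id            = C.id
  ; _∘_           = λ f g → g C.∘ f
  ; isEquivalence = C.isEquivalence
  ; ∘-cong        = λ p q → C.∘-cong q p
  ; assoc         = C.Equiv.sym C.assoc
  ; identityˡ     = C.identityʳ
  ; identityʳ     = C.identityˡ
  }
  where module C = Category C

Setoids : ∀ c ℓ → Category (lsuc (c ⊔ ℓ)) (c ⊔ ℓ) (c ⊔ ℓ)
Setoids c ℓ = record
  { Obj           = Setoid c ℓ
  ; _⇒_           = Func
  ; _≈_           = λ {A} {B} f g → ∀ x → Setoid._≈_ B (f ⟨$⟩ x) (g ⟨$⟩ x)
  ; id            = λ {A} → Id.function A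
  ; _∘_           = λ g f → Comp.function f g
  ; isEquivalence = λ {A} {B} → record
    { refl  = λ _ → Setoid.refl B
    ; sym   = λ p x → Setoid.sym B (p x)
    ; trans = λ p q x → Setoid.trans B (p x) (q x)
    }
  ; ∘-cong        = λ {A} {B} {C} {f} {h} {g} {k} p q x →
                    Setoid.trans C (Func.cong f (q x)) (p (k ⟨$⟩ x))
  ; assoc         = λ {A} {B} {C} {D} _ → Setoid.refl D
  ; identityˡ     = λ {A} {B} _ → Setoid.refl B
  ; identityʳ     = λ {A} {B} _ → Setoid.refl B
  }

record NaturalTransformation {C : Category o ℓ e} {D : Category o′ ℓ′ e′}
                             (F G : Functor C D) : Set (o ⊔ ℓ ⊔ ℓ′ ⊔ e′) where
  private
    module C = Category C
    module F = Functor F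
    module G = Functor G
  open Category D
  field
    η       : ∀ A → F.F₀ A ⇒ G.F₀ A
    natural : ∀ {A B} (f : A C.⇒ B) → η B ∘ F.F₁ f ≈ G.F₁ f ∘ η A

Functors : (C : Category o ℓ e) (D : Category o′ ℓ′ e′) →
           Category (o ⊔ ℓ ⊔ e ⊔ o′ ⊔ ℓ′ ⊔ e′) (o ⊔ ℓ ⊔ ℓ′ ⊔ e′) (o ⊔ e′)
Functors C D = record
  { Obj           = Functor C D
  ; _⇒_           = NaturalTransformation
  ; _≈_           = λ α β → ∀ A → η α A ≈ η β A
  ; id            = record
    { η       = λ _ → id
    ; natural = λ _ → trans identityˡ (sym identityʳ)
    }
  ; _∘_           = λ β α → record
    { η       = λ A → η β A ∘ η α A
    ; natural = λ f → trans assoc (trans (∘-cong refl (natural α f))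
                (trans (sym assoc) (trans (∘-cong (natural β f) refl) assoc)))
    }
  ; isEquivalence = record
    { refl  = λ _ → refl
    ; sym   = λ p A → sym (p A)
    ; trans = λ p q A → trans (p A) (q A)
    }
  ; ∘-cong        = λ p q A → ∘-cong (p A) (q A)
  ; assoc         = λ _ → assoc
  ; identityˡ     = λ _ → identityˡ
  ; identityʳ     = λ _ → identityʳ
  }
  where
    open Category D
    open Equiv
    open NaturalTransformation

FullSubcategory : (C : Category o ℓ e) → (Category.Obj C → Set p) → Category (o ⊔ p) ℓ e
FullSubcategory C P = record
  { Obj           = Σ Obj P
  ; _⇒_           = _⇒_ on proj₁
  ; _≈_           = _≈_
  ; id            = id
  ; _∘_           = _∘_
  ; isEquivalence = isEquivalence
  ; ∘-cong        = ∘-cong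
  ; assoc         = assoc
  ; identityˡ     = identityˡ
  ; identityʳ     = identityʳ
  }
  where open Category C

Inclusion : {C : Category o ℓ e} (P : Category.Obj C → Set p) →
            Functor (FullSubcategory C P) C
Inclusion {C = C} P = record
  { F₀           = proj₁
  ; F₁           = λ f → f
  ; identity     = refl
  ; homomorphism = refl
  ; F-cong       = λ f≈g → f≈g
  }
  where open Category.Equiv C

-- Set^(C^op); the levels are those of the hom-setoids, so that representables land here.
Presheaf : Category o ℓ e → Set (o ⊔ lsuc ℓ ⊔ lsuc e)
Presheaf {ℓ = ℓ} {e = e} C = Functor (op C) (Setoids ℓ e)

Presheaves : (C : Category o ℓ e) → Category (o ⊔ lsuc ℓ ⊔ lsuc e) (o ⊔ ℓ ⊔ e) (o ⊔ ℓ ⊔ e)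
Presheaves {ℓ = ℓ} {e = e} C = Functors (op C) (Setoids ℓ e)

module _ (C : Category o ℓ e) where
  open Category C
  open Equiv

  representable : Obj → Presheaf C
  representable B = record
    { F₀           = λ A → hom-setoid A B
    ; F₁           = λ f → record { to = _∘ f ; cong = λ p → ∘-cong p refl }
    ; identity     = λ _ → identityʳ
    ; homomorphism = λ _ → sym assoc
    ; F-cong       = λ f≈g _ → ∘-cong refl f≈g
    }

  Yoneda : Functor C (Presheaves C)
  Yoneda = record
    { F₀           = representable
    ; F₁           = λ g → record
      { η       = λ _ → record { to = g ∘_ ; cong = ∘-cong refl }
      ; natural = λ _ _ → sym assoc
      }
    ; identity     = λ _ _ → identityˡ
    ; homomorphism = λ _ _ → assoc
    ; F-cong       = λ f≈g _ _ → ∘-cong f≈g refl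
    }

module _ (C : Category o ℓ e) where
  open Category C

  Mono : ∀ {A B} → A ⇒ B → Set (o ⊔ ℓ ⊔ e)
  Mono {A} m = ∀ {W} (f g : W ⇒ A) → m ∘ f ≈ m ∘ g → f ≈ g

  IsIso : ∀ {A B} → A ⇒ B → Set (ℓ ⊔ e)
  IsIso f = ∃[ g ] g ∘ f ≈ id × f ∘ g ≈ id

  SplitMono : ∀ {A B} → A ⇒ B → Set (ℓ ⊔ e)
  SplitMono m = ∃[ r ] r ∘ m ≈ id

  -- In both records the arrows f m n g form the square
  --
  --       f
  --    A ---> B
  --  m |      | n
  --    v      v
  --    C ---> D
  --       g

  record IsPullback {A B C D} (f : A ⇒ B) (m : A ⇒ C) (n : B ⇒ D) (g : C ⇒ D) :
                    Set (o ⊔ ℓ ⊔ e) where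
    field
      commute   : n ∘ f ≈ g ∘ m
      universal : ∀ {Q} (h : Q ⇒ B) (k : Q ⇒ C) → n ∘ h ≈ g ∘ k →
                  ∃! _≈_ λ (u : Q ⇒ A) → f ∘ u ≈ h × m ∘ u ≈ k

  record IsPushout {A B C D} (f : A ⇒ B) (m : A ⇒ C) (n : B ⇒ D) (g : C ⇒ D) :
                   Set (o ⊔ ℓ ⊔ e) where
    field
      commute   : n ∘ f ≈ g ∘ m
      universal : ∀ {Q} (h : B ⇒ Q) (k : C ⇒ Q) → h ∘ f ≈ k ∘ m →
                  ∃! _≈_ λ (u : D ⇒ Q) → u ∘ n ≈ h × u ∘ g ≈ k

  HasPullbacks : Set (o ⊔ ℓ ⊔ e)
  HasPullbacks = ∀ {B C D} (n : B ⇒ D) (g : C ⇒ D) →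
                 Σ[ A ∈ Obj ] Σ[ f ∈ A ⇒ B ] Σ[ m ∈ A ⇒ C ] IsPullback f m n g

  record IsStablePushout {A B C D} (f : A ⇒ B) (m : A ⇒ C) (n : B ⇒ D) (g : C ⇒ D) :
                         Set (o ⊔ ℓ ⊔ e) where
    field
      isPushout : IsPushout f m n g
      stable    : ∀ {A′ B′ C′ D′}
                  (f′ : A′ ⇒ B′) (m′ : A′ ⇒ C′) (n′ : B′ ⇒ D′) (g′ : C′ ⇒ D′)
                  (a : A′ ⇒ A) (b : B′ ⇒ B) (c : C′ ⇒ C) (d : D′ ⇒ D) →
                  n′ ∘ f′ ≈ g′ ∘ m′ →
                  IsPullback f′ a b f → IsPullback m′ a c m →
                  IsPullback n′ b d n → IsPullback g′ c d g →
                  IsPushout f′ m′ n′ g′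

PreservesPullbacks : {C : Category o ℓ e} {D : Category o′ ℓ′ e′} →
                     Functor C D → Set (o ⊔ ℓ ⊔ e ⊔ o′ ⊔ ℓ′ ⊔ e′)
PreservesPullbacks {C = C} {D = D} F =
  ∀ {P Q R S} {f : P ⇒ Q} {m : P ⇒ R} {n : Q ⇒ S} {g : R ⇒ S} →
  IsPullback C f m n g → IsPullback D (F₁ f) (F₁ m) (F₁ n) (F₁ g)
  where
    open Category C
    open Functor F

record ArrowClass (C : Category o ℓ e) (p : Level) : Set (o ⊔ ℓ ⊔ e ⊔ lsuc p) where
  open Category C
  field
    Member : ∀ {A B} → A ⇒ B → Set p
    resp   : ∀ {A B} {f g : A ⇒ B} → f ≈ g → Member f → Member g

infix 4 _∈_
_∈_ : {C : Category o ℓ e} {A B : Category.Obj C} →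
      Category._⇒_ C A B → ArrowClass C p → Set p
f ∈ 𝒜 = ArrowClass.Member 𝒜 f

infixr 7 _∩_
_∩_ : {C : Category o ℓ e} → ArrowClass C p → ArrowClass C q → ArrowClass C (p ⊔ q)
𝒜 ∩ ℬ = record
  { Member = λ f → f ∈ 𝒜 × f ∈ ℬ
  ; resp   = λ f≈g (a , b) → ArrowClass.resp 𝒜 f≈g a , ArrowClass.resp ℬ f≈g b
  }

module _ {C : Category o ℓ e} where
  open Category C

  ContainsIsos : ArrowClass C p → Set (o ⊔ ℓ ⊔ e ⊔ p)
  ContainsIsos 𝒜 = ∀ {A B} (f : A ⇒ B) → IsIso C f → f ∈ 𝒜

  ContainsSplitMonos : ArrowClass C p → Set (o ⊔ ℓ ⊔ e ⊔ p)
  ContainsSplitMonos 𝒜 = ∀ {A B} (f : A ⇒ B) → SplitMono C f → f ∈ 𝒜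

  ClosedUnderComposition : ArrowClass C p → Set (o ⊔ ℓ ⊔ p)
  ClosedUnderComposition 𝒜 =
    ∀ {A B D} (f : A ⇒ B) (g : B ⇒ D) → f ∈ 𝒜 → g ∈ 𝒜 → g ∘ f ∈ 𝒜

  ClosedUnderDecompositionBy : ArrowClass C q → ArrowClass C p → Set (o ⊔ ℓ ⊔ p ⊔ q)
  ClosedUnderDecompositionBy ℬ 𝒜 =
    ∀ {A B D} (f : A ⇒ B) (g : B ⇒ D) → g ∘ f ∈ 𝒜 → g ∈ ℬ → f ∈ 𝒜

  ClosedUnderDecomposition : ArrowClass C p → Set (o ⊔ ℓ ⊔ p)
  ClosedUnderDecomposition 𝒜 = ClosedUnderDecompositionBy 𝒜 𝒜

  StableUnderPullbacks : ArrowClass C p → Set (o ⊔ ℓ ⊔ e ⊔ p)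
  StableUnderPullbacks 𝒜 =
    ∀ {P Q R S} {f : P ⇒ Q} {m : P ⇒ R} {n : Q ⇒ S} {g : R ⇒ S} →
    IsPullback C f m n g → n ∈ 𝒜 → m ∈ 𝒜

  StableUnderPushouts : ArrowClass C p → Set (o ⊔ ℓ ⊔ e ⊔ p)
  StableUnderPushouts 𝒜 =
    ∀ {P Q R S} {f : P ⇒ Q} {m : P ⇒ R} {n : Q ⇒ S} {g : R ⇒ S} →
    IsPushout C f m n g → m ∈ 𝒜 → n ∈ 𝒜

  record IsPreadhesiveStructure (ℳ : ArrowClass C p) (𝒩 : ArrowClass C q) :
                                Set (o ⊔ ℓ ⊔ e ⊔ p ⊔ q) where
    field
      ℳ-mono            : ∀ {A B} (m : A ⇒ B) → m ∈ ℳ → Mono C m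
      ℳ-isos            : ContainsIsos ℳ
      𝒩-isos            : ContainsIsos 𝒩
      ℳ-composition     : ClosedUnderComposition ℳ
      𝒩-composition     : ClosedUnderComposition 𝒩
      ℳ-decomposition   : ClosedUnderDecomposition ℳ
      𝒩-decomposition   : ClosedUnderDecomposition 𝒩
      𝒩-ℳ-decomposition : ClosedUnderDecompositionBy ℳ 𝒩
      ℳ-pullbacks       : StableUnderPullbacks ℳ
      𝒩-pullbacks       : StableUnderPullbacks 𝒩
      ℳ-pushouts        : StableUnderPushouts ℳ
      𝒩-pushouts        : StableUnderPushouts 𝒩

  record IsMNPushout (ℳ : ArrowClass C p) (𝒩 : ArrowClass C q) {A Y Z X : Obj}
                     (n : A ⇒ Z) (m : A ⇒ Y) (p′ : Z ⇒ X) (q′ : Y ⇒ X) :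
                     Set (o ⊔ ℓ ⊔ e ⊔ p ⊔ q) where
    field
      m∈ℳ       : m ∈ ℳ
      n∈𝒩       : n ∈ 𝒩
      isPushout : IsPushout C n m p′ q′

  IsPreadhesiveArrow : ArrowClass C q → {X Y : Obj} → X ⇒ Y → Set (o ⊔ ℓ ⊔ e ⊔ q)
  IsPreadhesiveArrow 𝒩 {X} {Y} m =
    ∀ {Z} (n : X ⇒ Z) → n ∈ 𝒩 →
    Σ[ W ∈ Obj ] Σ[ s ∈ Z ⇒ W ] Σ[ t ∈ Y ⇒ W ]
      IsStablePushout C n m s t × IsPullback C n m s t

  IsAdhesiveArrow : ArrowClass C q → {X Y : Obj} → X ⇒ Y → Set (o ⊔ ℓ ⊔ e ⊔ q)
  IsAdhesiveArrow 𝒩 {X} {Y} m =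
    ∀ {X′ Y′} {f : X′ ⇒ X} {m′ : X′ ⇒ Y′} {g : Y′ ⇒ Y} →
    IsPullback C f m′ m g → IsPreadhesiveArrow 𝒩 m′

module _ (C : Category o ℓ e) where
  open Category C

  record MonoInto (X : Obj) : Set (o ⊔ ℓ ⊔ e) where
    constructor mono
    field
      {dom}  : Obj
      arr    : dom ⇒ X
      isMono : Mono C arr

  -- The isomorphism classes of monos are not formed: the equality of the poset
  -- is isomorphism over X.
  Sub : Obj → Poset (o ⊔ ℓ ⊔ e) (ℓ ⊔ e) (ℓ ⊔ e)
  Sub X = record
    { Carrier        = MonoInto X
    ; _≈_            = _≅ₛ_
    ; _≤_            = _≤ₛ_
    ; isPartialOrder = record
      { isPreorder = record
        { isEquivalence = record
          { refl  = id , (id , identityˡ , identityˡ) , identityʳ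
          ; sym   = λ (i , (j , ji , ij) , p) →
                    j , (i , ij , ji) ,
                    trans (∘-cong (sym p) refl)
                      (trans assoc (trans (∘-cong refl ij) identityʳ))
          ; trans = λ (i , (i⁻ , i⁻i , ii⁻) , p) (j , (j⁻ , j⁻j , jj⁻) , q) →
                    j ∘ i ,
                    (i⁻ ∘ j⁻ , cancel j⁻j i⁻i , cancel ii⁻ jj⁻) ,
                    trans (sym assoc) (trans (∘-cong q refl) p)
          }
        ; reflexive     = λ (i , _ , p) → i , p
        ; trans         = λ (i , p) (j , q) →
                          j ∘ i , trans (sym assoc) (trans (∘-cong q refl) p)
        }
      ; antisym    = λ {m} {n} (i , p) (j , q) →
                     i ,
                     ( j
                     , isMono m (j ∘ i) id
                         (trans (sym assoc) (trans (∘-cong q refl) (trans p (sym identityʳ))))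
                     , isMono n (i ∘ j) id
                         (trans (sym assoc) (trans (∘-cong p refl) (trans q (sym identityʳ))))
                     ) ,
                     p
      }
    }
    where
      open Equiv
      open MonoInto

      _≤ₛ_ : MonoInto X → MonoInto X → Set (ℓ ⊔ e)
      m ≤ₛ n = Σ[ i ∈ dom m ⇒ dom n ] arr n ∘ i ≈ arr m

      _≅ₛ_ : MonoInto X → MonoInto X → Set (ℓ ⊔ e)
      m ≅ₛ n = Σ[ i ∈ dom m ⇒ dom n ] IsIso C i × arr n ∘ i ≈ arr m

      cancel : ∀ {P Q R} {i : P ⇒ Q} {i⁻ : Q ⇒ P} {j : Q ⇒ R} {j⁻ : R ⇒ Q} →
               j⁻ ∘ j ≈ id → i⁻ ∘ i ≈ id → (i⁻ ∘ j⁻) ∘ (j ∘ i) ≈ id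
      cancel jj ii = trans assoc (trans (∘-cong refl (trans (sym assoc)
                       (trans (∘-cong jj refl) identityˡ))) ii)

record IsJoin {c ℓ₁ ℓ₂} (P : Poset c ℓ₁ ℓ₂) (x y z : Poset.Carrier P) :
              Set (c ⊔ ℓ₂) where
  open Poset P
  field
    x≤z   : x ≤ z
    y≤z   : y ≤ z
    least : ∀ w → x ≤ w → y ≤ w → z ≤ w

module _ {C : Category o ℓ e} (ℳ : ArrowClass C p) (𝒩 : ArrowClass C q) where
  open Category C

  record IsMNUnion {X : Obj} (u : MonoInto C X) : Set (o ⊔ ℓ ⊔ e ⊔ p ⊔ q) where
    field
      m n   : MonoInto C X
      m∈ℳ   : MonoInto.arr m ∈ ℳ
      n∈ℳ∩𝒩 : MonoInto.arr n ∈ ℳ ∩ 𝒩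
      join  : IsJoin (Sub C X) m n u

  ClosedUnderMNUnions : Set (o ⊔ ℓ ⊔ e ⊔ p ⊔ q)
  ClosedUnderMNUnions = ∀ {X} (u : MonoInto C X) → IsMNUnion u → MonoInto.arr u ∈ ℳ

module _ (C : Category o ℓ e) where
  open Category C

  record Sink (X : Obj) : Set (o ⊔ ℓ ⊔ lsuc 0ℓ) where
    field
      I   : Set
      dom : I → Obj
      arr : ∀ i → dom i ⇒ X

  Coverage : (r : Level) → Set (o ⊔ ℓ ⊔ lsuc 0ℓ ⊔ lsuc r)
  Coverage r = ∀ X → Sink X → Set r

  module _ (F : Presheaf C) where
    open Functor F

    private
      El : Obj → Set ℓ
      El A = Setoid.Carrier (F₀ A)

      infix 4 _≈F_
      _≈F_ : ∀ {A} → El A → El A → Set e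
      _≈F_ {A} = Setoid._≈_ (F₀ A)

    Compatible : ∀ {X} (S : Sink X) → (∀ i → El (Sink.dom S i)) → Set (o ⊔ ℓ ⊔ e)
    Compatible S a = ∀ {i j W} (g : W ⇒ dom i) (h : W ⇒ dom j) →
                     arr i ∘ g ≈ arr j ∘ h → F₁ g ⟨$⟩ a i ≈F F₁ h ⟨$⟩ a j
      where open Sink S

    IsSheaf : Coverage r → Set (o ⊔ ℓ ⊔ e ⊔ lsuc 0ℓ ⊔ r)
    IsSheaf J = ∀ {X} (S : Sink X) → J X S → let open Sink S in
                (a : ∀ i → El (dom i)) → Compatible S a →
                ∃! _≈F_ λ (x : El X) → ∀ i → F₁ (arr i) ⟨$⟩ x ≈F a i

  Sh : (J : Coverage r) →
       Category (o ⊔ lsuc ℓ ⊔ lsuc e ⊔ lsuc 0ℓ ⊔ r) (o ⊔ ℓ ⊔ e) (o ⊔ ℓ ⊔ e)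
  Sh J = FullSubcategory (Presheaves C) (λ F → IsSheaf F J)

module _ {C : Category o ℓ e} where
  open Category C

  -- The set {p , q} as a Bool-indexed family.  When p and q coincide, this has
  -- the same sheaves as the singleton family: compatibility at the identities
  -- identifies the two components.
  pair : ∀ {X Y Z} → Z ⇒ X → Y ⇒ X → Sink C X
  pair {X} {Y} {Z} p q = record
    { I   = Bool
    ; dom = λ { true → Z ; false → Y }
    ; arr = λ { true → p ; false → q }
    }

  data 𝔧 (ℳ : ArrowClass C p) (𝒩 : ArrowClass C q) :
         Coverage C (o ⊔ ℓ ⊔ e ⊔ p ⊔ q ⊔ lsuc 0ℓ) where
    cover : ∀ {A X Y Z} {n : A ⇒ Z} {m : A ⇒ Y} {s : Z ⇒ X} {t : Y ⇒ X} →
            IsMNPushout ℳ 𝒩 n m s t → 𝔧 ℳ 𝒩 X (pair s t)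

{-# OPTIONS --safe #-}

-- Representables are sheaves because covering families are cocones of pushouts,
-- so the only substantial point is that an ℳ,𝒩-pushout s ∘ n ≈ t ∘ m stays a
-- pushout among sheaves.  By Yoneda this asks that elements b, c of a sheaf F
-- with F(n) b = F(m) c be compatible on {s , t}.  Since s is monic and the
-- square is a pullback, what is left is F(g) c = F(h) c whenever t ∘ g ≈ t ∘ h.
-- Let K and A₂ be the kernel pairs of t and n.  The diagonal A → A₂ lies in 𝒩,
-- so it has a stable pushout P along m, with a comparison u : P → K.  Stability
-- makes u monic, and then u is the union of A₂ and the diagonal C in K, so u ∈ ℳ.
-- By stability again K → C is the pushout of A₂ → K along A₂ → A; as P → C is the
-- pushout of A₂ → P along A₂ → A, the pushout of u along P → C is an identity.
-- This is an ℳ,𝒩-pushout, hence a pullback, so u is invertible: K is covered by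
-- A₂ and C, on both of which the two restrictions of c agree.
module Submission where

open import Defs
open import Level using (Level)
open import Data.Bool.Base using (true; false)
open import Data.Product using (_×_; _,_; proj₁; proj₂; Σ-syntax)
open import Function.Bundles using (Func; _⟨$⟩_)
open import Relation.Binary.Bundles using (Setoid)
open import Relation.Binary.PropositionalEquality.Core using () renaming (refl to ≡-refl)
import Relation.Binary.Reasoning.Setoid as SetoidReasoning

private
  variable
    o ℓ e p q : Level

-- Pullback, pushout and stable pushout squares in an arbitrary category.

module Squares (X : Category o ℓ e) where
  open Category X
  open Equiv public using (refl; sym; trans)
  private
    variable
      A B C D Q : Obj
      f g h k i j m n s t : A ⇒ B

  module ≈-Reasoning {A B : Obj} = SetoidReasoning (hom-setoid A B)
  open ≈-Reasoning

  infixr 4 refl⟩∘⟨_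
  infixl 5 _⟩∘⟨refl

  refl⟩∘⟨_ : g ≈ h → f ∘ g ≈ f ∘ h
  refl⟩∘⟨_ = ∘-cong refl

  _⟩∘⟨refl : f ≈ g → f ∘ h ≈ g ∘ h
  p ⟩∘⟨refl = ∘-cong p refl

  pullˡ : f ∘ g ≈ h → f ∘ (g ∘ k) ≈ h ∘ k
  pullˡ p = trans (sym assoc) (p ⟩∘⟨refl)

  pullʳ : f ∘ g ≈ h → (k ∘ f) ∘ g ≈ k ∘ h
  pullʳ p = trans assoc (refl⟩∘⟨ p)

  extendʳ : f ∘ g ≈ i ∘ j → f ∘ (g ∘ k) ≈ i ∘ (j ∘ k)
  extendʳ p = trans (pullˡ p) assoc

  extendˡ : f ∘ g ≈ i ∘ j → (k ∘ f) ∘ g ≈ (k ∘ i) ∘ j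
  extendˡ p = trans (pullʳ p) (sym assoc)

  module Pullback {f : A ⇒ B} {m : A ⇒ C} {n : B ⇒ D} {g : C ⇒ D}
                  (pb : IsPullback X f m n g) where
    open IsPullback pb public

    module _ {h : Q ⇒ B} {k : Q ⇒ C} (eq : n ∘ h ≈ g ∘ k) where
      ⟨_⟩ : Q ⇒ A
      ⟨_⟩ = proj₁ (universal h k eq)

      proj₁-⟨⟩ : f ∘ ⟨_⟩ ≈ h
      proj₁-⟨⟩ = proj₁ (proj₁ (proj₂ (universal h k eq)))

      proj₂-⟨⟩ : m ∘ ⟨_⟩ ≈ k
      proj₂-⟨⟩ = proj₂ (proj₁ (proj₂ (universal h k eq)))

    jointly-monic : {u v : Q ⇒ A} → f ∘ u ≈ f ∘ v → m ∘ u ≈ m ∘ v → u ≈ v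
    jointly-monic p q =
      trans (sym (unique (p , q))) (unique (refl , refl))
      where unique = λ {y} → proj₂ (proj₂ (universal _ _ (extendʳ commute))) {y}

  module Pushout {f : A ⇒ B} {m : A ⇒ C} {n : B ⇒ D} {g : C ⇒ D}
                 (po : IsPushout X f m n g) where
    open IsPushout po public

    module _ {h : B ⇒ Q} {k : C ⇒ Q} (eq : h ∘ f ≈ k ∘ m) where
      [_] : D ⇒ Q
      [_] = proj₁ (universal h k eq)

      []-inj₁ : [_] ∘ n ≈ h
      []-inj₁ = proj₁ (proj₁ (proj₂ (universal h k eq)))

      []-inj₂ : [_] ∘ g ≈ k
      []-inj₂ = proj₂ (proj₁ (proj₂ (universal h k eq)))

    jointly-epic : {u v : D ⇒ Q} → u ∘ n ≈ v ∘ n → u ∘ g ≈ v ∘ g → u ≈ v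
    jointly-epic p q =
      trans (sym (unique (p , q))) (unique (refl , refl))
      where unique = λ {y} → proj₂ (proj₂ (universal _ _ (extendˡ commute))) {y}

  splitMono⇒mono : (f : A ⇒ B) → SplitMono X f → Mono X f
  splitMono⇒mono f (r , rf) g h fg≈fh = begin
    g           ≈⟨ identityˡ ⟨
    id ∘ g      ≈⟨ pullˡ rf ⟨
    r ∘ f ∘ g   ≈⟨ refl⟩∘⟨ fg≈fh ⟩
    r ∘ f ∘ h   ≈⟨ pullˡ rf ⟩
    id ∘ h      ≈⟨ identityˡ ⟩
    h           ∎

  pullback-flip : IsPullback X f m n g → IsPullback X m f g n
  pullback-flip pb = record
    { commute   = sym commute
    ; universal = λ h k eq → ⟨ sym eq ⟩ , (proj₂-⟨⟩ (sym eq) , proj₁-⟨⟩ (sym eq)) ,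
                  λ (p , q) → jointly-monic (trans (proj₁-⟨⟩ (sym eq)) (sym q))
                                            (trans (proj₂-⟨⟩ (sym eq)) (sym p))
    }
    where open Pullback pb

  pushout-flip : IsPushout X f m n g → IsPushout X m f g n
  pushout-flip po = record
    { commute   = sym commute
    ; universal = λ h k eq → [ sym eq ] , ([]-inj₂ (sym eq) , []-inj₁ (sym eq)) ,
                  λ (p , q) → jointly-epic (trans ([]-inj₁ (sym eq)) (sym q))
                                           (trans ([]-inj₂ (sym eq)) (sym p))
    }
    where open Pushout po

  identity-pullback : (m : A ⇒ B) → IsPullback X id m m id
  identity-pullback m = record
    { commute   = trans identityʳ (sym identityˡ)
    ; universal = λ h k eq → h , (identityˡ , trans eq identityˡ) ,
                  λ (p , _) → trans (sym p) identityˡ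
    }

  -- A monic `i` cancels, so both cospans have the same cones. The composites appear as separate
  -- arrows `s` and `t`, so that taking `i` to be an identity replaces the legs by equal ones.
  pullback-extend : (i : D ⇒ Q) → Mono X i → i ∘ n ≈ s → i ∘ g ≈ t →
                    IsPullback X f m n g → IsPullback X f m s t
  pullback-extend {n = n} {s = s} {g = g} {t = t} {f = f} {m = m} i i-mono in≈s ig≈t pb = record
    { commute   = begin
        s ∘ f         ≈⟨ in≈s ⟩∘⟨refl ⟨
        (i ∘ n) ∘ f   ≈⟨ extendˡ commute ⟩
        (i ∘ g) ∘ m   ≈⟨ ig≈t ⟩∘⟨refl ⟩
        t ∘ m         ∎
    ; universal = λ h k eq → universal h k (i-mono _ _ (begin
        i ∘ n ∘ h   ≈⟨ pullˡ in≈s ⟩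
        s ∘ h       ≈⟨ eq ⟩
        t ∘ k       ≈⟨ pullˡ ig≈t ⟨
        i ∘ g ∘ k   ∎))
    }
    where open Pullback pb

  pullback-restrict : (i : D ⇒ Q) → i ∘ n ≈ s → i ∘ g ≈ t → n ∘ f ≈ g ∘ m →
                      IsPullback X f m s t → IsPullback X f m n g
  pullback-restrict {n = n} {s = s} {g = g} {t = t} i in≈s ig≈t commute pb = record
    { commute   = commute
    ; universal = λ h k eq → IsPullback.universal pb h k (begin
        s ∘ h         ≈⟨ in≈s ⟩∘⟨refl ⟨
        (i ∘ n) ∘ h   ≈⟨ extendˡ eq ⟩
        (i ∘ g) ∘ k   ≈⟨ ig≈t ⟩∘⟨refl ⟩
        t ∘ k         ∎)
    }

  -- Adhesivity provides one particular good pushout; this passes its properties on to any other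
  -- pushout of the same span. The comparison `φ` has the retraction `ψ`, hence is monic. A cube
  -- over the new square with vertical arrow `d` is therefore a cube over the old one with vertical
  -- arrow `φ ∘ d`.
  stablePullbackPushout-unique :
    IsStablePushout X f m s t → IsPullback X f m s t → IsPushout X f m n g →
    IsStablePushout X f m n g × IsPullback X f m n g
  stablePullbackPushout-unique {s = s} {t = t} {n = n} {g = g} sp pb po =
    record
      { isPushout = po
      ; stable    = λ f′ m′ n′ g′ a b c d commute′ left back right front →
          S.stable f′ m′ n′ g′ a b c (φ ∘ d) commute′ left back
            (pullback-extend φ φ-mono refl φn≈s right)
            (pullback-extend φ φ-mono refl φg≈t front)
      } ,
    pullback-restrict φ φn≈s φg≈t (IsPushout.commute po) pb
    where
      module S = IsStablePushout sp
      module P = Pushout po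
      module R = Pushout S.isPushout
      φ    = P.[ R.commute ]
      φn≈s = P.[]-inj₁ R.commute
      φg≈t = P.[]-inj₂ R.commute
      ψ    = R.[ P.commute ]

      φ-mono : Mono X φ
      φ-mono = splitMono⇒mono φ (ψ , P.jointly-epic
        (trans (pullʳ φn≈s) (trans (R.[]-inj₁ P.commute) (sym identityˡ)))
        (trans (pullʳ φg≈t) (trans (R.[]-inj₂ P.commute) (sym identityˡ))))

  -- By stability W is the pushout of the span pulled back along w, so u and v need
  -- only be compared on generalised elements lying over B or over C.
  stable-jointly-epic :
    HasPullbacks X → {f : A ⇒ B} {m : A ⇒ C} {n : B ⇒ D} {g : C ⇒ D} →
    IsStablePushout X f m n g → ∀ {W} (w : W ⇒ D) {u v : W ⇒ Q} →
    (∀ {V} (x : V ⇒ W) (b : V ⇒ B) → w ∘ x ≈ n ∘ b → u ∘ x ≈ v ∘ x) →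
    (∀ {V} (x : V ⇒ W) (c : V ⇒ C) → w ∘ x ≈ g ∘ c → u ∘ x ≈ v ∘ x) →
    u ≈ v
  stable-jointly-epic pullbacks {f = f} {m = m} {n = n} {g = g} sp w on-B on-C =
    Pushout.jointly-epic
      (S.stable f′ m′ n′ g′ a b c w (sym (P₃.proj₁-⟨⟩ eq)) leftPb backPb rightPb frontPb)
      (on-B n′ b P₁.commute) (on-C g′ c P₃.commute)
    where
      module S = IsStablePushout sp
      pb₁ = pullbacks w n
      n′ = proj₁ (proj₂ pb₁)
      b = proj₁ (proj₂ (proj₂ pb₁))
      rightPb = proj₂ (proj₂ (proj₂ pb₁))
      module P₁ = Pullback rightPb
      pb₂ = pullbacks b f
      f′ = proj₁ (proj₂ pb₂)
      a = proj₁ (proj₂ (proj₂ pb₂))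
      leftPb = proj₂ (proj₂ (proj₂ pb₂))
      module P₂ = Pullback leftPb
      pb₃ = pullbacks w g
      g′ = proj₁ (proj₂ pb₃)
      c = proj₁ (proj₂ (proj₂ pb₃))
      frontPb = proj₂ (proj₂ (proj₂ pb₃))
      module P₃ = Pullback frontPb

      eq : w ∘ (n′ ∘ f′) ≈ g ∘ (m ∘ a)
      eq = begin
        w ∘ n′ ∘ f′   ≈⟨ extendʳ P₁.commute ⟩
        n ∘ b ∘ f′    ≈⟨ refl⟩∘⟨ P₂.commute ⟩
        n ∘ f ∘ a     ≈⟨ extendʳ (IsPushout.commute S.isPushout) ⟩
        g ∘ m ∘ a     ∎

      m′ = P₃.⟨ eq ⟩

      -- The one face that is not a pullback by construction. The left and right faces paste to a
      -- pullback of `w` along `n ∘ f`, which equals `g ∘ m`; cancelling the front face leaves the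
      -- back one.
      backPb : IsPullback X m′ a c m
      backPb = record
        { commute   = P₃.proj₂-⟨⟩ eq
        ; universal = λ h k ch≈mk →
            let
              wg′h≈nfk : w ∘ (g′ ∘ h) ≈ n ∘ (f ∘ k)
              wg′h≈nfk = begin
                w ∘ g′ ∘ h   ≈⟨ extendʳ P₃.commute ⟩
                g ∘ c ∘ h    ≈⟨ refl⟩∘⟨ ch≈mk ⟩
                g ∘ m ∘ k    ≈⟨ extendʳ (IsPushout.commute S.isPushout) ⟨
                n ∘ f ∘ k    ∎
              bz≈fk = P₁.proj₂-⟨⟩ wg′h≈nfk
              u = P₂.⟨ bz≈fk ⟩
              au≈k = P₂.proj₂-⟨⟩ bz≈fk
              m′u≈h : m′ ∘ u ≈ h
              m′u≈h = P₃.jointly-monic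
                (begin
                  g′ ∘ m′ ∘ u            ≈⟨ pullˡ (P₃.proj₁-⟨⟩ eq) ⟩
                  (n′ ∘ f′) ∘ u          ≈⟨ pullʳ (P₂.proj₁-⟨⟩ bz≈fk) ⟩
                  n′ ∘ P₁.⟨ wg′h≈nfk ⟩   ≈⟨ P₁.proj₁-⟨⟩ wg′h≈nfk ⟩
                  g′ ∘ h                 ∎)
                (begin
                  c ∘ m′ ∘ u    ≈⟨ pullˡ (P₃.proj₂-⟨⟩ eq) ⟩
                  (m ∘ a) ∘ u   ≈⟨ pullʳ au≈k ⟩
                  m ∘ k         ≈⟨ ch≈mk ⟨
                  c ∘ h         ∎)
            in u , (m′u≈h , au≈k) , λ (p , q) →
               jointly-monic (trans m′u≈h (sym p)) (trans au≈k (sym q))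
        }
        where
          jointly-monic : ∀ {u v : Q ⇒ _} → m′ ∘ u ≈ m′ ∘ v → a ∘ u ≈ a ∘ v → u ≈ v
          jointly-monic {u = u} {v} m′u≈m′v au≈av = P₂.jointly-monic
            (P₁.jointly-monic
              (begin
                n′ ∘ f′ ∘ u   ≈⟨ extendʳ (P₃.proj₁-⟨⟩ eq) ⟨
                g′ ∘ m′ ∘ u   ≈⟨ refl⟩∘⟨ m′u≈m′v ⟩
                g′ ∘ m′ ∘ v   ≈⟨ extendʳ (P₃.proj₁-⟨⟩ eq) ⟩
                n′ ∘ f′ ∘ v   ∎)
              (begin
                b ∘ f′ ∘ u   ≈⟨ extendʳ P₂.commute ⟩
                f ∘ a ∘ u    ≈⟨ refl⟩∘⟨ au≈av ⟩
                f ∘ a ∘ v    ≈⟨ extendʳ P₂.commute ⟨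
                b ∘ f′ ∘ v   ∎))
            au≈av

-- ℳ,𝒩-pushouts in the presence of adhesivity.

module _ {X : Category o ℓ e} {ℳ : ArrowClass X p} {𝒩 : ArrowClass X q}
         (pullbacks : HasPullbacks X)
         (preadhesive : IsPreadhesiveStructure ℳ 𝒩)
         (adhesive : ∀ {A B} (m : Category._⇒_ X A B) → m ∈ ℳ → IsAdhesiveArrow 𝒩 m)
         where
  open Category X
  open Squares X
  open ≈-Reasoning
  open IsPreadhesiveStructure preadhesive
  private
    variable
      A B C D : Obj
      n m s t : A ⇒ B

  -- An arrow is a pullback of itself along identities, so an adhesive `m` is preadhesive and has a
  -- stable pushout along `n` that is a pullback. Uniqueness of pushouts carries this over to the
  -- given square.
  MNPushout-stable-pullback :
    IsMNPushout ℳ 𝒩 n m s t → IsStablePushout X n m s t × IsPullback X n m s t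
  MNPushout-stable-pullback {n = n} {m = m} po =
    let _ , _ , _ , stable , pb = adhesive m m∈ℳ (identity-pullback m) n n∈𝒩
    in stablePullbackPushout-unique stable pb isPushout
    where open IsMNPushout po

  MNPushout⇒pullback : IsMNPushout ℳ 𝒩 n m s t → IsPullback X n m s t
  MNPushout⇒pullback po = proj₂ (MNPushout-stable-pullback po)

  MNPushout-exists : ∀ {A Y Z} (n : A ⇒ Z) (m : A ⇒ Y) → n ∈ 𝒩 → m ∈ ℳ →
    Σ[ W ∈ Obj ] Σ[ s ∈ Z ⇒ W ] Σ[ t ∈ Y ⇒ W ] IsMNPushout ℳ 𝒩 n m s t
  MNPushout-exists n m n∈𝒩 m∈ℳ =
    let W , s , t , stable , _ = adhesive m m∈ℳ (identity-pullback m) n n∈𝒩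
    in W , s , t , record
      { m∈ℳ = m∈ℳ ; n∈𝒩 = n∈𝒩 ; isPushout = IsStablePushout.isPushout stable }

  -- Pull both f and g back along the cocone: on the four resulting pieces they
  -- agree, on the mixed ones because the two subobjects meet in A.
  union-mono : ∀ {A Y Z P K} {n : A ⇒ Z} {m : A ⇒ Y} {s : Z ⇒ P} {t : Y ⇒ P} (u : P ⇒ K) →
    IsMNPushout ℳ 𝒩 n m s t → IsPullback X n m (u ∘ s) (u ∘ t) →
    Mono X (u ∘ s) → Mono X (u ∘ t) → Mono X u
  union-mono {P = P} {n = n} {m} {s} {t} u po pb us-mono ut-mono f g uf≈ug =
    on-pieces f
      (λ x b fx≈sb → on-pieces (g ∘ x)
        (λ y c gxy≈sc → agree ss x fx≈sb y gxy≈sc)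
        (λ y c gxy≈tc → agree st x fx≈sb y gxy≈tc))
      (λ x b fx≈tb → on-pieces (g ∘ x)
        (λ y c gxy≈sc → agree ts x fx≈tb y gxy≈sc)
        (λ y c gxy≈tc → agree tt x fx≈tb y gxy≈tc))
    where
      module Po = IsPushout (IsMNPushout.isPushout po)
      open Pullback pb

      on-pieces = λ {W} {Q} w {u′} {v} →
        stable-jointly-epic {Q = Q} pullbacks (proj₁ (MNPushout-stable-pullback po)) {W} w {u′} {v}

      MonicOn : ∀ {E E′} → E ⇒ P → E′ ⇒ P → Set _
      MonicOn {E} {E′} α β = ∀ {V} (b : V ⇒ E) (c : V ⇒ E′) →
                             (u ∘ α) ∘ b ≈ (u ∘ β) ∘ c → α ∘ b ≈ β ∘ c

      ss : MonicOn s s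
      ss b c eq = refl⟩∘⟨ us-mono b c eq

      tt : MonicOn t t
      tt b c eq = refl⟩∘⟨ ut-mono b c eq

      st : MonicOn s t
      st b c eq = begin
        s ∘ b            ≈⟨ refl⟩∘⟨ proj₁-⟨⟩ eq ⟨
        s ∘ n ∘ ⟨ eq ⟩   ≈⟨ extendʳ Po.commute ⟩
        t ∘ m ∘ ⟨ eq ⟩   ≈⟨ refl⟩∘⟨ proj₂-⟨⟩ eq ⟩
        t ∘ c            ∎

      ts : MonicOn t s
      ts b c eq = sym (st c b (sym eq))

      agree : ∀ {E E′ V W} {α : E ⇒ P} {β : E′ ⇒ P} {b : V ⇒ E} {c : W ⇒ E′} →
              MonicOn α β → ∀ x → f ∘ x ≈ α ∘ b → ∀ y → (g ∘ x) ∘ y ≈ β ∘ c →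
              (f ∘ x) ∘ y ≈ (g ∘ x) ∘ y
      agree {α = α} {β} {b} {c} monic x fx≈αb y gxy≈βc = begin
        (f ∘ x) ∘ y   ≈⟨ fx≈αb ⟩∘⟨refl ⟩
        (α ∘ b) ∘ y   ≈⟨ assoc ⟩
        α ∘ b ∘ y     ≈⟨ monic (b ∘ y) c uαby≈uβc ⟩
        β ∘ c         ≈⟨ gxy≈βc ⟨
        (g ∘ x) ∘ y   ∎
        where
          uαby≈uβc : (u ∘ α) ∘ (b ∘ y) ≈ (u ∘ β) ∘ c
          uαby≈uβc = begin
            (u ∘ α) ∘ b ∘ y   ≈⟨ assoc ⟩
            u ∘ α ∘ b ∘ y     ≈⟨ refl⟩∘⟨ pullˡ (sym fx≈αb) ⟩
            u ∘ (f ∘ x) ∘ y   ≈⟨ refl⟩∘⟨ assoc ⟩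
            u ∘ f ∘ x ∘ y     ≈⟨ extendʳ uf≈ug ⟩
            u ∘ g ∘ x ∘ y     ≈⟨ refl⟩∘⟨ assoc ⟨
            u ∘ (g ∘ x) ∘ y   ≈⟨ refl⟩∘⟨ gxy≈βc ⟩
            u ∘ β ∘ c         ≈⟨ assoc ⟨
            (u ∘ β) ∘ c       ∎

  -- The kernel pair of a leg of an ℳ,𝒩-pushout.

  module KernelPairs
    (splitMonos : ContainsSplitMonos (ℳ ∩ 𝒩)) (unions : ClosedUnderMNUnions ℳ 𝒩)
    {A B C D : Obj} {n : A ⇒ B} {m : A ⇒ C} {s : B ⇒ D} {t : C ⇒ D}
    (po : IsMNPushout ℳ 𝒩 n m s t) where

    open IsMNPushout po using (m∈ℳ; n∈𝒩)
    private
      module Po = IsPushout (IsMNPushout.isPushout po)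
      square : IsPullback X n m s t
      square = MNPushout⇒pullback po
      module Sq = Pullback square
      kerₙ = pullbacks n n
      kerₜ = pullbacks t t

    A₂ K : Obj
    A₂ = proj₁ kerₙ
    K = proj₁ kerₜ

    π₁ π₂ : A₂ ⇒ A
    π₁ = proj₁ (proj₂ kerₙ)
    π₂ = proj₁ (proj₂ (proj₂ kerₙ))

    p₁ p₂ : K ⇒ C
    p₁ = proj₁ (proj₂ kerₜ)
    p₂ = proj₁ (proj₂ (proj₂ kerₜ))

    module A₂ = Pullback (proj₂ (proj₂ (proj₂ kerₙ)))
    module K = Pullback (proj₂ (proj₂ (proj₂ kerₜ)))

    m-mono : Mono X m
    m-mono = ℳ-mono m m∈ℳ

    tmπ₁≈tmπ₂ : t ∘ (m ∘ π₁) ≈ t ∘ (m ∘ π₂)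
    tmπ₁≈tmπ₂ = begin
      t ∘ m ∘ π₁   ≈⟨ extendʳ Po.commute ⟨
      s ∘ n ∘ π₁   ≈⟨ refl⟩∘⟨ A₂.commute ⟩
      s ∘ n ∘ π₂   ≈⟨ extendʳ Po.commute ⟩
      t ∘ m ∘ π₂   ∎

    i : A₂ ⇒ K
    i = K.⟨ tmπ₁≈tmπ₂ ⟩

    p₁i≈mπ₁ : p₁ ∘ i ≈ m ∘ π₁
    p₁i≈mπ₁ = K.proj₁-⟨⟩ tmπ₁≈tmπ₂

    p₂i≈mπ₂ : p₂ ∘ i ≈ m ∘ π₂
    p₂i≈mπ₂ = K.proj₂-⟨⟩ tmπ₁≈tmπ₂

    δ : A ⇒ A₂
    δ = A₂.⟨ refl {x = n ∘ id} ⟩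

    π₁δ≈id : π₁ ∘ δ ≈ id
    π₁δ≈id = A₂.proj₁-⟨⟩ refl

    π₂δ≈id : π₂ ∘ δ ≈ id
    π₂δ≈id = A₂.proj₂-⟨⟩ refl

    δ∈ℳ∩𝒩 : δ ∈ ℳ ∩ 𝒩
    δ∈ℳ∩𝒩 = splitMonos δ (π₁ , π₁δ≈id)

    d : C ⇒ K
    d = K.⟨ refl {x = t ∘ id} ⟩

    p₁d≈id : p₁ ∘ d ≈ id
    p₁d≈id = K.proj₁-⟨⟩ refl

    p₂d≈id : p₂ ∘ d ≈ id
    p₂d≈id = K.proj₂-⟨⟩ refl

    d-mono : Mono X d
    d-mono = splitMono⇒mono d (p₁ , p₁d≈id)

    -- If the first component of a pair in `K` is `m ∘ k`, its second component is identified by `t`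
    -- with `s ∘ n ∘ k`. The pullback `square` then lifts the second component through `m` to some
    -- `z` with `n ∘ z ≈ n ∘ k`, so `k` and `z` form a pair in `A₂`. This puts `i` in ℳ and supplies
    -- a face of the cube behind `K-pushout`.
    i-pullback : IsPullback X i π₁ p₁ m
    i-pullback = record
      { commute   = p₁i≈mπ₁
      ; universal = λ h k p₁h≈mk →
          let
            snk≈tp₂h : s ∘ (n ∘ k) ≈ t ∘ (p₂ ∘ h)
            snk≈tp₂h = begin
              s ∘ n ∘ k    ≈⟨ extendʳ Po.commute ⟩
              t ∘ m ∘ k    ≈⟨ refl⟩∘⟨ p₁h≈mk ⟨
              t ∘ p₁ ∘ h   ≈⟨ extendʳ K.commute ⟩
              t ∘ p₂ ∘ h   ∎
            nk≈nz = sym (Sq.proj₁-⟨⟩ snk≈tp₂h)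
            v = A₂.⟨ nk≈nz ⟩
            π₁v≈k = A₂.proj₁-⟨⟩ nk≈nz
            iv≈h : i ∘ v ≈ h
            iv≈h = K.jointly-monic
              (begin
                p₁ ∘ i ∘ v   ≈⟨ extendʳ p₁i≈mπ₁ ⟩
                m ∘ π₁ ∘ v   ≈⟨ refl⟩∘⟨ π₁v≈k ⟩
                m ∘ k        ≈⟨ p₁h≈mk ⟨
                p₁ ∘ h       ∎)
              (begin
                p₂ ∘ i ∘ v             ≈⟨ extendʳ p₂i≈mπ₂ ⟩
                m ∘ π₂ ∘ v             ≈⟨ refl⟩∘⟨ A₂.proj₂-⟨⟩ nk≈nz ⟩
                m ∘ Sq.⟨ snk≈tp₂h ⟩    ≈⟨ Sq.proj₂-⟨⟩ snk≈tp₂h ⟩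
                p₂ ∘ h                 ∎)
          in v , (iv≈h , π₁v≈k) , λ (iv′≈h , π₁v′≈k) →
             jointly-monic (trans iv≈h (sym iv′≈h)) (trans π₁v≈k (sym π₁v′≈k))
      }
      where
        jointly-monic : ∀ {Q} {u v : Q ⇒ A₂} → i ∘ u ≈ i ∘ v → π₁ ∘ u ≈ π₁ ∘ v → u ≈ v
        jointly-monic {u = u} {v} iu≈iv π₁u≈π₁v = A₂.jointly-monic π₁u≈π₁v
          (m-mono _ _ (begin
            m ∘ π₂ ∘ u   ≈⟨ extendʳ p₂i≈mπ₂ ⟨
            p₂ ∘ i ∘ u   ≈⟨ refl⟩∘⟨ iu≈iv ⟩
            p₂ ∘ i ∘ v   ≈⟨ extendʳ p₂i≈mπ₂ ⟩
            m ∘ π₂ ∘ v   ∎))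

    i∈ℳ : i ∈ ℳ
    i∈ℳ = ℳ-pullbacks (pullback-flip i-pullback) m∈ℳ

    i-mono : Mono X i
    i-mono = ℳ-mono i i∈ℳ

    -- The given pushout pulled back along its own leg `t`: above `B`, `C` and `A` lie `A`, `K` and
    -- `A₂`.
    K-pushout : IsPushout X π₂ i m p₂
    K-pushout = IsStablePushout.stable (proj₁ (MNPushout-stable-pullback po))
      π₂ i m p₂ π₁ n p₁ t (sym p₂i≈mπ₂)
      (pullback-flip (proj₂ (proj₂ (proj₂ kerₙ)))) i-pullback
      (pullback-flip square) (pullback-flip (proj₂ (proj₂ (proj₂ kerₜ))))

    -- The pushout `P` of the diagonal and its comparison with `K`.

    private
      pushoutOfDiagonal = MNPushout-exists δ m (proj₂ δ∈ℳ∩𝒩) m∈ℳ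

    P : Obj
    P = proj₁ pushoutOfDiagonal

    j : A₂ ⇒ P
    j = proj₁ (proj₂ pushoutOfDiagonal)

    k : C ⇒ P
    k = proj₁ (proj₂ (proj₂ pushoutOfDiagonal))

    P-MNPushout : IsMNPushout ℳ 𝒩 δ m j k
    P-MNPushout = proj₂ (proj₂ (proj₂ pushoutOfDiagonal))

    module P = Pushout (IsMNPushout.isPushout P-MNPushout)

    iδ≈dm : i ∘ δ ≈ d ∘ m
    iδ≈dm = K.jointly-monic (restrict p₁i≈mπ₁ π₁δ≈id p₁d≈id) (restrict p₂i≈mπ₂ π₂δ≈id p₂d≈id)
      where
        restrict : ∀ {p : K ⇒ C} {π : A₂ ⇒ A} → p ∘ i ≈ m ∘ π → π ∘ δ ≈ id → p ∘ d ≈ id →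
                   p ∘ (i ∘ δ) ≈ p ∘ (d ∘ m)
        restrict {p} {π} pi≈mπ πδ≈id pd≈id = begin
          p ∘ i ∘ δ   ≈⟨ extendʳ pi≈mπ ⟩
          m ∘ π ∘ δ   ≈⟨ refl⟩∘⟨ πδ≈id ⟩
          m ∘ id      ≈⟨ identityʳ ⟩
          m           ≈⟨ identityˡ ⟨
          id ∘ m      ≈⟨ pullˡ pd≈id ⟨
          p ∘ d ∘ m   ∎

    u : P ⇒ K
    u = P.[ iδ≈dm ]

    uj≈i : u ∘ j ≈ i
    uj≈i = P.[]-inj₁ iδ≈dm

    uk≈d : u ∘ k ≈ d
    uk≈d = P.[]-inj₂ iδ≈dm

    -- The subobjects `i` and `d` of `K` meet in `A`: a pair in `A₂` whose image under `m` is
    -- diagonal is itself diagonal, because `m` is monic.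
    diagonal-pullback : IsPullback X δ m i d
    diagonal-pullback = record
      { commute   = iδ≈dm
      ; universal = λ h l ih≈dl →
          let
            mπ₁h≈l : m ∘ (π₁ ∘ h) ≈ l
            mπ₁h≈l = trans (extendʳ (sym p₁i≈mπ₁))
                       (trans (refl⟩∘⟨ ih≈dl) (trans (pullˡ p₁d≈id) identityˡ))
            mπ₂h≈l : m ∘ (π₂ ∘ h) ≈ l
            mπ₂h≈l = trans (extendʳ (sym p₂i≈mπ₂))
                       (trans (refl⟩∘⟨ ih≈dl) (trans (pullˡ p₂d≈id) identityˡ))
            π₁h≈π₂h = m-mono _ _ (trans mπ₁h≈l (sym mπ₂h≈l))
            δπ₁h≈h : δ ∘ (π₁ ∘ h) ≈ h
            δπ₁h≈h = A₂.jointly-monic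
              (trans (pullˡ π₁δ≈id) identityˡ)
              (trans (pullˡ π₂δ≈id) (trans identityˡ π₁h≈π₂h))
          in π₁ ∘ h , (δπ₁h≈h , mπ₁h≈l) , λ (_ , mz≈l) → m-mono _ _ (trans mπ₁h≈l (sym mz≈l))
      }

    u-mono : Mono X u
    u-mono = union-mono u P-MNPushout
      -- The extension along `id` only rewrites the legs `i` and `d` as `u ∘ j` and `u ∘ k`.
      (pullback-extend id (splitMono⇒mono id (id , identityˡ))
        (trans identityˡ (sym uj≈i)) (trans identityˡ (sym uk≈d)) diagonal-pullback)
      (λ f g eq → i-mono f g (trans (sym uj≈i ⟩∘⟨refl) (trans eq (uj≈i ⟩∘⟨refl))))
      (λ f g eq → d-mono f g (trans (sym uk≈d ⟩∘⟨refl) (trans eq (uk≈d ⟩∘⟨refl))))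

    u∈ℳ : u ∈ ℳ
    u∈ℳ = unions (mono u u-mono) record
      { m      = mono i i-mono
      ; n      = mono d d-mono
      ; m∈ℳ    = i∈ℳ
      ; n∈ℳ∩𝒩  = splitMonos d (p₁ , p₁d≈id)
      ; join   = record
        { x≤z   = j , uj≈i
        ; y≤z   = k , uk≈d
        -- Since `w` is monic, the factorisations of `i` and `d` through it form a cocone under `δ`
        -- and `m`, which induces an arrow out of `P`.
        ; least = λ (mono w w-mono) (a , wa≈i) (b , wb≈d) →
            let
              aδ≈bm : a ∘ δ ≈ b ∘ m
              aδ≈bm = w-mono _ _ (begin
                w ∘ a ∘ δ   ≈⟨ pullˡ wa≈i ⟩
                i ∘ δ       ≈⟨ iδ≈dm ⟩
                d ∘ m       ≈⟨ pullˡ wb≈d ⟨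
                w ∘ b ∘ m   ∎)
            in P.[ aδ≈bm ] , P.jointly-epic
                 (trans (pullʳ (P.[]-inj₁ aδ≈bm)) (trans wa≈i (sym uj≈i)))
                 (trans (pullʳ (P.[]-inj₂ aδ≈bm)) (trans wb≈d (sym uk≈d)))
        }
      }

    p₂uj≈mπ₂ : (p₂ ∘ u) ∘ j ≈ m ∘ π₂
    p₂uj≈mπ₂ = trans (pullʳ uj≈i) p₂i≈mπ₂

    p₂uk≈id : (p₂ ∘ u) ∘ k ≈ id
    p₂uk≈id = trans (pullʳ uk≈d) p₂d≈id

    p₁uj≈mπ₁ : (p₁ ∘ u) ∘ j ≈ m ∘ π₁
    p₁uj≈mπ₁ = trans (pullʳ uj≈i) p₁i≈mπ₁

    p₁uk≈id : (p₁ ∘ u) ∘ k ≈ id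
    p₁uk≈id = trans (pullʳ uk≈d) p₁d≈id

    -- Pushout cancellation. Pasted after the square defining `P`, this square gives a rectangle
    -- with horizontal sides `π₂ ∘ δ` and `(p₂ ∘ u) ∘ k`, both identities; such a rectangle is a
    -- pushout. The factorisation `l ∘ k` is read off from it.
    P-pushout : IsPushout X π₂ j m (p₂ ∘ u)
    P-pushout = record
      { commute   = sym p₂uj≈mπ₂
      ; universal = λ h l hπ₂≈lj →
          let
            lkm≈h : (l ∘ k) ∘ m ≈ h
            lkm≈h = begin
              (l ∘ k) ∘ m    ≈⟨ extendˡ P.commute ⟨
              (l ∘ j) ∘ δ    ≈⟨ hπ₂≈lj ⟩∘⟨refl ⟨
              (h ∘ π₂) ∘ δ   ≈⟨ pullʳ π₂δ≈id ⟩
              h ∘ id         ≈⟨ identityʳ ⟩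
              h              ∎
            lkp₂u≈l : (l ∘ k) ∘ (p₂ ∘ u) ≈ l
            lkp₂u≈l = P.jointly-epic
              (begin
                ((l ∘ k) ∘ (p₂ ∘ u)) ∘ j   ≈⟨ pullʳ p₂uj≈mπ₂ ⟩
                (l ∘ k) ∘ m ∘ π₂           ≈⟨ pullˡ lkm≈h ⟩
                h ∘ π₂                     ≈⟨ hπ₂≈lj ⟩
                l ∘ j                      ∎)
              (trans (pullʳ p₂uk≈id) identityʳ)
          in l ∘ k , (lkm≈h , lkp₂u≈l) , λ {v} (_ , vp₂u≈l) → begin
               l ∘ k                ≈⟨ vp₂u≈l ⟩∘⟨refl ⟨
               (v ∘ p₂ ∘ u) ∘ k     ≈⟨ pullʳ p₂uk≈id ⟩
               v ∘ id               ≈⟨ identityʳ ⟩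
               v                    ∎
      }

    -- Pushout cancellation again: as `i` is `u ∘ j`, `K-pushout` is `P-pushout` followed by this
    -- square. Membership of `p₂ ∘ u` in 𝒩 comes from `n`, by pulling back to `π₂` and then pushing
    -- out.
    u-MNPushout : IsMNPushout ℳ 𝒩 (p₂ ∘ u) u id p₂
    u-MNPushout = record
      { m∈ℳ       = u∈ℳ
      ; n∈𝒩       = 𝒩-pushouts (pushout-flip P-pushout)
                      (𝒩-pullbacks (proj₂ (proj₂ (proj₂ kerₙ))) n∈𝒩)
      ; isPushout = record
        { commute   = identityˡ
        ; universal = λ h l hp₂u≈lu →
            let
              hmπ₂≈li : (h ∘ m) ∘ π₂ ≈ l ∘ i
              hmπ₂≈li = begin
                (h ∘ m) ∘ π₂         ≈⟨ pullʳ (sym p₂uj≈mπ₂) ⟩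
                h ∘ (p₂ ∘ u) ∘ j     ≈⟨ pullˡ hp₂u≈lu ⟩
                (l ∘ u) ∘ j          ≈⟨ pullʳ uj≈i ⟩
                l ∘ i                ∎
              v = Pushout.[_] K-pushout hmπ₂≈li
              vp₂≈l = Pushout.[]-inj₂ K-pushout hmπ₂≈li
              -- The diagonal `d` is a section of `p₂` and factors through `u`, so restricting along
              -- it compares the two arrows.
              v≈h : v ≈ h
              v≈h = begin
                v                    ≈⟨ identityʳ ⟨
                v ∘ id               ≈⟨ refl⟩∘⟨ p₂d≈id ⟨
                v ∘ p₂ ∘ d           ≈⟨ pullˡ vp₂≈l ⟩
                l ∘ d                ≈⟨ refl⟩∘⟨ uk≈d ⟨
                l ∘ u ∘ k            ≈⟨ pullˡ (sym hp₂u≈lu) ⟩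
                (h ∘ p₂ ∘ u) ∘ k     ≈⟨ pullʳ p₂uk≈id ⟩
                h ∘ id               ≈⟨ identityʳ ⟩
                h                    ∎
            in h , (identityʳ , trans (sym v≈h ⟩∘⟨refl) vp₂≈l) ,
               λ (v′id≈h , _) → trans (sym v′id≈h) identityʳ
        }
      }

    private
      module U = Pullback (MNPushout⇒pullback u-MNPushout)
      idp₂≈p₂id : id ∘ p₂ ≈ p₂ ∘ id
      idp₂≈p₂id = trans identityˡ (sym identityʳ)

    -- The pullback property makes `u` a pullback of the identity of `C`, so the cone formed by `p₂`
    -- and the identity of `K` yields a section of `u`. The section lets equalities of restrictions
    -- to `P` descend to `K`.
    u⁻¹ : K ⇒ P
    u⁻¹ = U.⟨ idp₂≈p₂id ⟩

    uu⁻¹≈id : u ∘ u⁻¹ ≈ id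
    uu⁻¹≈id = U.proj₂-⟨⟩ idp₂≈p₂id

-- Representables are sheaves.

module _ {X : Category o ℓ e} {ℳ : ArrowClass X p} {𝒩 : ArrowClass X q} where
  open Category X
  open Squares X

  representable-isSheaf : ∀ E → IsSheaf X (representable X E) (𝔧 ℳ 𝒩)
  representable-isSheaf E _ (cover {n = n} {m = m} po) a compatible =
    [ eq ] , (λ { true → []-inj₁ eq ; false → []-inj₂ eq }) ,
    λ v → jointly-epic (trans ([]-inj₁ eq) (sym (v true)))
                       (trans ([]-inj₂ eq) (sym (v false)))
    where
      open Pushout (IsMNPushout.isPushout po)
      -- For a representable, compatibility at the span itself is the cocone condition.
      eq : a true ∘ n ≈ a false ∘ m
      eq = compatible {true} {false} n m commute

  -- The action on arrows is literally that of `Yoneda`, so composing with the inclusion gives a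
  -- strict equality of functors by reflexivity.
  sheafYoneda : Functor X (Sh X (𝔧 ℳ 𝒩))
  sheafYoneda = record
    { F₀           = λ E → representable X E , representable-isSheaf E
    ; F₁           = F₁
    ; identity     = λ {E} → identity {E}
    ; homomorphism = λ {A} {B} {C} {f} {g} → homomorphism {A} {B} {C} {f} {g}
    ; F-cong       = F-cong
    }
    where open Functor (Yoneda X)

-- Elements of presheaves and the Yoneda lemma.

module _ (X : Category o ℓ e) where
  open Category X

  module Restriction (F : Presheaf X) where
    open Functor F

    El : Obj → Set ℓ
    El A = Setoid.Carrier (F₀ A)

    module _ {A : Obj} where
      open Setoid (F₀ A) public using ()
        renaming (_≈_ to _≋_; refl to ≋-refl; sym to ≋-sym; trans to ≋-trans)

    infixr 9 _·_
    _·_ : ∀ {A B} → A ⇒ B → El B → El A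
    f · x = F₁ f ⟨$⟩ x

    ·-cong : ∀ {A B} {f g : A ⇒ B} {x y} → f ≈ g → x ≋ y → f · x ≋ g · y
    ·-cong {f = f} {y = y} f≈g x≋y = ≋-trans (Func.cong (F₁ f) x≋y) (F-cong f≈g y)

    ∘-· : ∀ {A B C} (f : A ⇒ B) (g : B ⇒ C) {x} → (g ∘ f) · x ≋ f · g · x
    ∘-· f g {x} = homomorphism x

    id-· : ∀ {A} {x : El A} → id · x ≋ x
    id-· {x = x} = identity x

    -- Both `x` and `y` amalgamate the compatible family of restrictions of `y`.
    separated : ∀ {r} {J : Coverage X r} → IsSheaf X F J → ∀ {A} {S : Sink X A} → J A S →
                ∀ {x y} → (∀ i → Sink.arr S i · x ≋ Sink.arr S i · y) → x ≋ y
    separated sheaf {S = S} covering {x} {y} agree =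
      ≋-trans (≋-sym (unique agree)) (unique λ _ → ≋-refl)
      where
        open Sink S
        unique = λ {z} → proj₂ (proj₂ (sheaf S covering (λ i → arr i · y)
          λ g h eq → ≋-trans (≋-sym (∘-· g _)) (≋-trans (·-cong eq ≋-refl) (∘-· h _)))) {z}

  module _ {F : Presheaf X} where
    open Functor F using (F₁)
    open Restriction F
    open NaturalTransformation
    open Squares X using (sym)

    fromElement : ∀ {A} → El A → NaturalTransformation (representable X A) F
    fromElement x = record
      { η       = λ _ → record { to = _· x ; cong = λ f≈g → ·-cong f≈g ≋-refl }
      ; natural = λ f g → ∘-· f g
      }

    toElement : ∀ {A} → NaturalTransformation (representable X A) F → El A
    toElement {A} α = η α A ⟨$⟩ id

    η-toElement : ∀ {A W} (α : NaturalTransformation (representable X A) F) (f : W ⇒ A) →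
                  η α W ⟨$⟩ f ≋ f · toElement α
    η-toElement {W = W} α f =
      ≋-trans (Func.cong (η α W) (sym identityˡ)) (natural α f id)

-- Fullness, faithfulness and preservation of pullbacks.

module _ {X : Category o ℓ e} {ℳ : ArrowClass X p} {𝒩 : ArrowClass X q} where
  open Category X
  open Squares X
  open NaturalTransformation

  sheafYoneda-full : Full (sheafYoneda {X = X} {ℳ} {𝒩})
  sheafYoneda-full {B = B} α =
    toElement X {F = representable X B} α , λ _ f → sym (η-toElement X {F = representable X B} α f)

  sheafYoneda-faithful : Faithful (sheafYoneda {X = X} {ℳ} {𝒩})
  sheafYoneda-faithful f g eq = trans (sym identityʳ) (trans (eq _ id) identityʳ)

  -- A cone of sheaves evaluated at an element over `W` is a cone with vertex `W` in the base
  -- category, so factorisations are built elementwise; joint monicity makes them respect equality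
  -- and restriction.
  sheafYoneda-pullbacks : PreservesPullbacks (sheafYoneda {X = X} {ℳ} {𝒩})
  sheafYoneda-pullbacks pb = record
    { commute   = λ _ f → extendʳ commute
    ; universal = λ h k eq →
        record
          { η       = λ W → record
            { to   = λ x → ⟨ eq W x ⟩
            ; cong = λ {x} {y} x≈y → jointly-monic
                (trans (proj₁-⟨⟩ (eq W x))
                  (trans (Func.cong (η h W) x≈y) (sym (proj₁-⟨⟩ (eq W y)))))
                (trans (proj₂-⟨⟩ (eq W x))
                  (trans (Func.cong (η k W) x≈y) (sym (proj₂-⟨⟩ (eq W y)))))
            }
          ; natural = λ f x → jointly-monic
              (trans (proj₁-⟨⟩ (eq _ _))
                (trans (natural h f x) (sym (pullˡ (proj₁-⟨⟩ (eq _ x))))))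
              (trans (proj₂-⟨⟩ (eq _ _))
                (trans (natural k f x) (sym (pullˡ (proj₂-⟨⟩ (eq _ x))))))
          } ,
        ((λ W x → proj₁-⟨⟩ (eq W x)) , (λ W x → proj₂-⟨⟩ (eq W x))) ,
        λ (p , q) W x → jointly-monic
          (trans (proj₁-⟨⟩ (eq W x)) (sym (p W x)))
          (trans (proj₂-⟨⟩ (eq W x)) (sym (q W x)))
    }
    where open Pullback pb

-- Preservation of ℳ,𝒩-pushouts.

module _ {X : Category o ℓ e} {ℳ : ArrowClass X p} {𝒩 : ArrowClass X q}
         (pullbacks : HasPullbacks X)
         (preadhesive : IsPreadhesiveStructure ℳ 𝒩)
         (adhesive : ∀ {A B} (m : Category._⇒_ X A B) → m ∈ ℳ → IsAdhesiveArrow 𝒩 m)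
         (splitMonos : ContainsSplitMonos (ℳ ∩ 𝒩)) (unions : ClosedUnderMNUnions ℳ 𝒩)
         where
  open Category X
  open Squares X

  module _ {A B C D : Obj} {n : A ⇒ B} {m : A ⇒ C} {s : B ⇒ D} {t : C ⇒ D}
           (po : IsMNPushout ℳ 𝒩 n m s t) where
    private
      module Po = IsPushout (IsMNPushout.isPushout po)
      module Sq = Pullback (MNPushout⇒pullback pullbacks preadhesive adhesive po)

    module _ (F : Presheaf X) (sheaf : IsSheaf X F (𝔧 ℳ 𝒩)) where
      open Restriction X F

      module _ {b : El B} {c : El C} (nb≋mc : n · b ≋ m · c) where

        module _ where
          open KernelPairs pullbacks preadhesive adhesive splitMonos unions po

          kernelPair-compatible : p₁ · c ≋ p₂ · c
          kernelPair-compatible = begin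
            p₁ · c                 ≈⟨ ·-cong (expand p₁) ≋-refl ⟩
            ((p₁ ∘ u) ∘ u⁻¹) · c   ≈⟨ ∘-· u⁻¹ (p₁ ∘ u) ⟩
            u⁻¹ · (p₁ ∘ u) · c     ≈⟨ ·-cong refl on-P ⟩
            u⁻¹ · (p₂ ∘ u) · c     ≈⟨ ∘-· u⁻¹ (p₂ ∘ u) ⟨
            ((p₂ ∘ u) ∘ u⁻¹) · c   ≈⟨ ·-cong (expand p₂) ≋-refl ⟨
            p₂ · c                 ∎
            where
              open SetoidReasoning (Functor.F₀ F K)

              expand : (f : K ⇒ C) → f ≈ (f ∘ u) ∘ u⁻¹
              expand f = sym (trans (pullʳ uu⁻¹≈id) identityʳ)

              restrict-A₂ : ∀ {f : P ⇒ C} {π} → f ∘ j ≈ m ∘ π → j · f · c ≋ π · n · b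
              restrict-A₂ {f} {π} fj≈mπ =
                ≋-trans (≋-sym (∘-· j f)) (≋-trans (·-cong fj≈mπ ≋-refl)
                  (≋-trans (∘-· π m) (·-cong refl (≋-sym nb≋mc))))

              restrict-C : ∀ {f : P ⇒ C} → f ∘ k ≈ id → k · f · c ≋ c
              restrict-C {f} fk≈id =
                ≋-trans (≋-sym (∘-· k f)) (≋-trans (·-cong fk≈id ≋-refl) id-·)

              π₁nb≋π₂nb : π₁ · n · b ≋ π₂ · n · b
              π₁nb≋π₂nb =
                ≋-trans (≋-sym (∘-· π₁ n)) (≋-trans (·-cong A₂.commute ≋-refl) (∘-· π₂ n))

              -- The square defining `P` makes `j` and `k` a covering family. Along `j` the element
              -- `c` turns into `n · b`, whose restrictions along `π₁` and `π₂` agree because `A₂`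
              -- is the kernel pair of `n`; along `k` both sides reduce to `c`.
              on-P : (p₁ ∘ u) · c ≋ (p₂ ∘ u) · c
              on-P = separated sheaf (cover P-MNPushout) λ where
                true  → ≋-trans (restrict-A₂ p₁uj≈mπ₁)
                          (≋-trans π₁nb≋π₂nb (≋-sym (restrict-A₂ p₂uj≈mπ₂)))
                false → ≋-trans (restrict-C p₁uk≈id) (≋-sym (restrict-C p₂uk≈id))

          pushout-leg-compatible : ∀ {W} (g h : W ⇒ C) → t ∘ g ≈ t ∘ h → g · c ≋ h · c
          pushout-leg-compatible g h eq = begin
            g · c              ≈⟨ ·-cong (K.proj₁-⟨⟩ eq) ≋-refl ⟨
            (p₁ ∘ w) · c       ≈⟨ ∘-· w p₁ ⟩
            w · p₁ · c         ≈⟨ ·-cong refl kernelPair-compatible ⟩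
            w · p₂ · c         ≈⟨ ∘-· w p₂ ⟨
            (p₂ ∘ w) · c       ≈⟨ ·-cong (K.proj₂-⟨⟩ eq) ≋-refl ⟩
            h · c              ∎
            where
              open SetoidReasoning (Functor.F₀ F _)
              w = K.⟨ eq ⟩

        pushout-legs-compatible : ∀ {W} (g : W ⇒ B) (h : W ⇒ C) → s ∘ g ≈ t ∘ h → g · b ≋ h · c
        pushout-legs-compatible g h eq = begin
          g · b              ≈⟨ ·-cong (Sq.proj₁-⟨⟩ eq) ≋-refl ⟨
          (n ∘ w) · b        ≈⟨ ∘-· w n ⟩
          w · n · b          ≈⟨ ·-cong refl nb≋mc ⟩
          w · m · c          ≈⟨ ∘-· w m ⟨
          (m ∘ w) · c        ≈⟨ ·-cong (Sq.proj₂-⟨⟩ eq) ≋-refl ⟩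
          h · c              ∎
          where
            open SetoidReasoning (Functor.F₀ F _)
            w = Sq.⟨ eq ⟩

        family : ∀ i → El (Sink.dom (pair {C = X} s t) i)
        family true  = b
        family false = c

        family-compatible : Compatible X F (pair s t) family
        -- As a pushout of `m`, the leg `s` lies in ℳ and is monic, so `g` and `h` coincide.
        family-compatible {true}  {true}  g h eq = ·-cong (s-mono g h eq) ≋-refl
          where
            open IsMNPushout po
            open IsPreadhesiveStructure preadhesive
            s-mono = ℳ-mono s (ℳ-pushouts isPushout m∈ℳ)
        family-compatible {true}  {false} g h eq = pushout-legs-compatible g h eq
        family-compatible {false} {true}  g h eq = ≋-sym (pushout-legs-compatible h g (sym eq))
        family-compatible {false} {false} g h eq = pushout-leg-compatible g h eq

        amalgamation : Σ[ x ∈ El D ] s · x ≋ b × t · x ≋ c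
        amalgamation =
          let x , restricts , _ = sheaf (pair s t) (cover po) family family-compatible
          in x , restricts true , restricts false

    -- By Yoneda a cocone into a sheaf `F` is a pair of elements over `B` and `C` with the same
    -- restriction to `A`, and a factorisation is an element over `D` restricting to both. Existence
    -- is `amalgamation`; uniqueness is separatedness for the cover by `s` and `t`.
    sheafYoneda-pushout :
      let open Functor (sheafYoneda {X = X} {ℳ} {𝒩}) in
      IsPushout (Sh X (𝔧 ℳ 𝒩)) {F₀ A} {F₀ B} {F₀ C} {F₀ D} (F₁ n) (F₁ m) (F₁ s) (F₁ t)
    sheafYoneda-pushout = record
      { commute   = λ _ f → extendʳ Po.commute
      ; universal = λ {F} → universal (proj₁ F) (proj₂ F)
      }
      where
        open NaturalTransformation
        open Category (Presheaves X) using () renaming (_∘_ to _∘ᴾ_; _≈_ to _≈ᴾ_)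
        open Functor (Yoneda X) using () renaming (F₁ to y)

        universal : ∀ F → IsSheaf X F (𝔧 ℳ 𝒩) →
          (h : NaturalTransformation (representable X B) F)
          (k : NaturalTransformation (representable X C) F) →
          h ∘ᴾ y n ≈ᴾ k ∘ᴾ y m → _
        universal F sheaf h k eq = fromElement X {F = F} x ,
          ((λ _ f → ≋-trans (∘-· f s) (≋-trans (·-cong refl sx≋b) (≋-sym (η-toElement X h f)))) ,
           (λ _ f → ≋-trans (∘-· f t) (≋-trans (·-cong refl tx≋c) (≋-sym (η-toElement X k f))))) ,
          λ {v} (p , q) → unique v p q
          where
            open Restriction X F
            -- The equation of transformations is evaluated at the identity of `A`.
            nb≋mc : n · toElement X h ≋ m · toElement X k
            nb≋mc = ≋-trans (≋-sym (η-toElement X h n))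
              (≋-trans (Func.cong (η h A) (sym identityʳ)) (≋-trans (eq A id)
                (≋-trans (Func.cong (η k A) identityʳ) (η-toElement X k m))))
            glued = amalgamation F sheaf nb≋mc
            x = proj₁ glued
            sx≋b = proj₁ (proj₂ glued)
            tx≋c = proj₂ (proj₂ glued)

            restrict : ∀ {E} (f : E ⇒ D) (v : NaturalTransformation (representable X D) F)
              (l : NaturalTransformation (representable X E) F) →
              v ∘ᴾ y f ≈ᴾ l → f · toElement X v ≋ toElement X l
            restrict {E} f v l vf≈l = ≋-trans (≋-sym (η-toElement X v f))
              (≋-trans (Func.cong (η v E) (sym identityʳ)) (vf≈l E id))

            unique : (v : NaturalTransformation (representable X D) F) →
              v ∘ᴾ y s ≈ᴾ h → v ∘ᴾ y t ≈ᴾ k → fromElement X {F = F} x ≈ᴾ v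
            unique v vs≈h vt≈k _ f = ≋-trans (·-cong refl x≋v) (≋-sym (η-toElement X v f))
              where
                x≋v : x ≋ toElement X v
                x≋v = separated sheaf (cover po) λ where
                  true  → ≋-trans sx≋b (≋-sym (restrict s v h vs≈h))
                  false → ≋-trans tx≋c (≋-sym (restrict t v k vt≈k))

theorem6p6 : ∀ {o ℓ e p q} (X : Category o ℓ e) (ℳ : ArrowClass X p) (𝒩 : ArrowClass X q) →
    let open Category X in
    HasPullbacks X →
    IsPreadhesiveStructure ℳ 𝒩 →
    (∀ {A B} (m : A ⇒ B) → m ∈ ℳ → IsAdhesiveArrow 𝒩 m) →
    ContainsSplitMonos (ℳ ∩ 𝒩) →
    ClosedUnderMNUnions ℳ 𝒩 →
    Σ[ Y′ ∈ Functor X (Sh X (𝔧 ℳ 𝒩)) ]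
    (Inclusion (λ F → IsSheaf X F (𝔧 ℳ 𝒩)) ∘F Y′ ≡F Yoneda X × Full Y′ × Faithful Y′) ×
    (PreservesPullbacks Y′ ×
    (∀ {A B C D} {n : A ⇒ B} {m : A ⇒ C} {s : B ⇒ D} {t : C ⇒ D} →
    IsMNPushout ℳ 𝒩 n m s t →
    let open Functor Y′ in
    IsPushout (Sh X (𝔧 ℳ 𝒩)) {F₀ A} {F₀ B} {F₀ C} {F₀ D} (F₁ n) (F₁ m) (F₁ s) (F₁ t)))
theorem6p6 X ℳ 𝒩 pullbacks preadhesive adhesive splitMonos unions =
  sheafYoneda ,
  ( record { eq₀ = λ _ → ≡-refl ; eq₁ = λ _ _ _ → refl }
  , sheafYoneda-full {X = X} {ℳ} {𝒩} , sheafYoneda-faithful {X = X} {ℳ} {𝒩}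
  ) ,
  sheafYoneda-pullbacks ,
  sheafYoneda-pushout pullbacks preadhesive adhesive splitMonos unions
  where open Squares X using (refl)
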